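{- Let $(G,\gamma)$ be an edge-colored graph with $n$ vertices, $m$ edges, at least two colors, and $s$ colors that are each used exactly once in the graph $G$. If $n-2>m-s$, then $\operatorname{wld}(G)=n-1$.
   Context: An edge-colored graph $(G,\gamma)$ is a finite connected graph $G$ with a surjective function $\gamma:E(G)\to\mathcal{C}=\{c_1,\dots,c_\ell\}$ onto a finite set of colors (not necessarily a proper edge-coloring). For each color $c_i$ let $E_i(G)=\{e\in E(G):\gamma(e)=c_i\}$; the color $c_i$ is used exactly $t$ times if $|E_i(G)|=t$. For $W\subseteq E(G)$, let $G_i^W$ be the graph with vertex set $V(G)$ and edge set $W\cup E_i(G)$. The set $W$ is color-connecting if $G_i^W$ is connected for every color $c_i\in\mathcal{C}$. The wild number $\operatorname{wld}(G)$ is the minimum size of a color-connecting set. -}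

module Defs where

open import Data.Fin using (Fin)
import Data.Fin as Fin
open import Data.Fin.Subset using (Subset; _∈_; _∪_; ∣_∣; ⊤)
open import Data.Nat using (ℕ; NonZero; _≤_; _≟_)
open import Data.Product using (∃-syntax; _×_; _,_)
open import Data.Sum using (_⊎_)
open import Data.Vec using (tabulate)
open import Function.Definitions using (Surjective)
open import Relation.Binary.Construct.Closure.ReflexiveTransitive using (Star)
open import Relation.Binary.PropositionalEquality using (_≡_)
open import Relation.Nullary using (does)

-- A graph with vertex set Fin n and edge set Fin m.  The order of the two
-- ends of an edge carries no meaning (see Adjacent); loops and parallel
-- edges are allowed, so simple graphs are a special case.
record Graph (n m : ℕ) : Set where
  field
    ends : Fin m → Fin n × Fin n

module _ {n m : ℕ} (G : Graph n m) where
  open Graph G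

  -- Adjacency in the graph (V(G), S), for a set of edges S.
  Adjacent : Subset m → Fin n → Fin n → Set
  Adjacent S u v = ∃[ e ] (e ∈ S × (ends e ≡ (u , v) ⊎ ends e ≡ (v , u)))

  -- The graph (V(G), S) is connected; the graph without vertices is not.
  Connected : Subset m → Set
  Connected S = NonZero n × (∀ u v → Star (Adjacent S) u v)

record EdgeColoredGraph (n m ℓ : ℕ) : Set where
  field
    graph        : Graph n m
    connected    : Connected graph ⊤
    γ            : Fin m → Fin ℓ
    γ-surjective : Surjective _≡_ _≡_ γ

module _ {n m ℓ : ℕ} (G : EdgeColoredGraph n m ℓ) where
  open EdgeColoredGraph G

  colorClass : Fin ℓ → Subset m
  colorClass i = tabulate (λ e → does (γ e Fin.≟ i))

  colorsUsedExactly : ℕ → Subset ℓ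
  colorsUsedExactly t = tabulate (λ i → does (∣ colorClass i ∣ ≟ t))

  ColorConnecting : Subset m → Set
  ColorConnecting W = ∀ i → Connected graph (W ∪ colorClass i)

  -- wld(G) = k, the defining property of the minimum.  Such a k is unique,
  -- and exists because the set of all edges is color-connecting.
  WildNumberIs : ℕ → Set
  WildNumberIs k =
    (∃[ W ] (ColorConnecting W × ∣ W ∣ ≡ k)) ×
    (∀ W → ColorConnecting W → k ≤ ∣ W ∣)

{-# OPTIONS --safe #-}
-- Adding a color class to a color-connecting set W gives a connected graph, which has
-- at least n - 1 edges.  If ∣W∣ < n - 1, the edge of a color used once must lie
-- outside W, so s ≤ m - ∣W∣; and if such a color exists then n - 2 ≤ ∣W∣, whence
-- n - 2 ≤ m - s.  If s = 0, already n - 1 ≤ m.  The value n - 1 is attained by a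
-- spanning tree.
module Submission where

open import Data.Fin using (Fin; zero; suc)
import Data.Fin as Fin
open import Data.Fin.Properties using (suc-injective; ¬∀⟶∃¬)
open import Data.Fin.Subset using (Subset; inside; outside; _∈_; _∉_; _⊆_; _∪_; ∣_∣; ⊤; ⊥; ⁅_⁆; ∁)
  renaming (_-_ to _∖_)
open import Data.Fin.Subset.Properties
import Data.Integer as ℤ
import Data.Integer.Properties as ℤ
import Data.Integer.Tactic.RingSolver as ℤ-Solver
open import Data.Nat using (ℕ; zero; suc; _+_; _∸_; _≤_; _<_; _≥_; z≤n; s≤s; _≟_; _≤?_)
open import Data.Nat.Properties hiding (suc-injective)
open import Data.Product using (∃-syntax; _×_; _,_; proj₁; proj₂)
open import Data.Sum using (inj₁; inj₂; [_,_]′; swap)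
open import Data.Vec using ([]; _∷_; here; there; tabulate)
open import Data.Vec.Properties using (lookup∘tabulate; []=⇒lookup; lookup⇒[]=)
open import Function using (_∘_)
open import Relation.Binary.Construct.Closure.ReflexiveTransitive using (Star; ε; _◅_; _◅◅_; reverse)
import Relation.Binary.Construct.Closure.ReflexiveTransitive as Star
open import Relation.Binary.PropositionalEquality using (_≡_; refl; sym; trans; cong; subst)
open import Relation.Nullary using (Dec; does; yes; no; contradiction)
open import Relation.Nullary.Decidable using (dec-true)
open import Defs

-- Cardinalities of subsets, and walks leaving a subset.

∣p∪q∣≤∣p∣+∣q∣ : ∀ {n} (p q : Subset n) → ∣ p ∪ q ∣ ≤ ∣ p ∣ + ∣ q ∣
∣p∪q∣≤∣p∣+∣q∣ []            []            = z≤n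
∣p∪q∣≤∣p∣+∣q∣ (outside ∷ p) (outside ∷ q) = ∣p∪q∣≤∣p∣+∣q∣ p q
∣p∪q∣≤∣p∣+∣q∣ (outside ∷ p) (inside  ∷ q) =
  ≤-trans (s≤s (∣p∪q∣≤∣p∣+∣q∣ p q)) (≤-reflexive (sym (+-suc ∣ p ∣ ∣ q ∣)))
∣p∪q∣≤∣p∣+∣q∣ (inside  ∷ p) (outside ∷ q) = s≤s (∣p∪q∣≤∣p∣+∣q∣ p q)
∣p∪q∣≤∣p∣+∣q∣ (inside  ∷ p) (inside  ∷ q) =
  s≤s (≤-trans (∣p∪q∣≤∣p∣+∣q∣ p q) (+-monoʳ-≤ ∣ p ∣ (n≤1+n ∣ q ∣)))

x∉p⇒∣p∪⁅x⁆∣≡1+∣p∣ : ∀ {n x} {p : Subset n} → x ∉ p → ∣ p ∪ ⁅ x ⁆ ∣ ≡ suc ∣ p ∣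
x∉p⇒∣p∪⁅x⁆∣≡1+∣p∣ {x = x} {p} x∉p = ≤-antisym upper lower
  where
  upper : ∣ p ∪ ⁅ x ⁆ ∣ ≤ suc ∣ p ∣
  upper = begin
    ∣ p ∪ ⁅ x ⁆ ∣     ≤⟨ ∣p∪q∣≤∣p∣+∣q∣ p ⁅ x ⁆ ⟩
    ∣ p ∣ + ∣ ⁅ x ⁆ ∣ ≡⟨ cong (∣ p ∣ +_) (∣⁅x⁆∣≡1 x) ⟩
    ∣ p ∣ + 1         ≡⟨ +-comm ∣ p ∣ 1 ⟩
    suc ∣ p ∣         ∎
    where open ≤-Reasoning
  lower : suc ∣ p ∣ ≤ ∣ p ∪ ⁅ x ⁆ ∣
  lower = p⊂q⇒∣p∣<∣q∣ (p⊆p∪q ⁅ x ⁆ , x , q⊆p∪q p ⁅ x ⁆ (x∈⁅x⁆ x) , x∉p)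

∈-tabulate⁺ : ∀ {n} {P : Fin n → Set} (P? : ∀ x → Dec (P x)) {x} →
              P x → x ∈ tabulate (does ∘ P?)
∈-tabulate⁺ P? {x} px =
  lookup⇒[]= x _ (trans (lookup∘tabulate (does ∘ P?) x) (dec-true (P? x) px))

∈-tabulate⁻ : ∀ {n} {P : Fin n → Set} (P? : ∀ x → Dec (P x)) {x} →
              x ∈ tabulate (does ∘ P?) → P x
∈-tabulate⁻ P? {x} x∈
  with P? x | trans (sym (lookup∘tabulate (does ∘ P?) x)) ([]=⇒lookup x∈)
... | yes px | _ = px

-- Distinct elements of `p` need distinct witnesses in `q`, so the witness of the head can be
-- deleted from `q` and the induction goes on with the tail: by `unique` it covers nothing else. A
-- relation is used instead of a function `Fin b → Fin a` because, seen from the tail, the map is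
-- only partial.
∣p∣≤∣q∣-by-covering : ∀ {a b} (R : Fin b → Fin a → Set) →
  (∀ {y x x′} → R y x → R y x′ → x ≡ x′) →
  (p : Subset a) (q : Subset b) →
  (∀ {x} → x ∈ p → ∃[ y ] (y ∈ q × R y x)) →
  ∣ p ∣ ≤ ∣ q ∣
∣p∣≤∣q∣-by-covering R unique [] q cover = z≤n
∣p∣≤∣q∣-by-covering R unique (outside ∷ p) q cover =
  ∣p∣≤∣q∣-by-covering (λ y x → R y (suc x)) (λ r r′ → suc-injective (unique r r′)) p q (cover ∘ there)
∣p∣≤∣q∣-by-covering R unique (inside ∷ p) q cover with cover here
... | y₀ , y₀∈q , Ry₀0 = ≤-trans
  (s≤s (∣p∣≤∣q∣-by-covering (λ y x → R y (suc x)) (λ r r′ → suc-injective (unique r r′)) p (q ∖ y₀) cover′))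
  (x∈p⇒∣p-x∣<∣p∣ y₀∈q)
  where
  cover′ : ∀ {x} → x ∈ p → ∃[ y ] (y ∈ q ∖ y₀ × R y (suc x))
  cover′ x∈p with cover (there x∈p)
  ... | y , y∈q , Ryx = y , x∈p∧x≢y⇒x∈p-y y∈q (λ { refl → contradiction (unique Ry₀0 Ryx) λ () }) , Ryx

-- The first step of the walk that leaves `U` is the one wanted.
∃-crossing : ∀ {n} {R : Fin n → Fin n → Set} (U : Subset n) {u v} →
  Star R u v → u ∈ U → v ∉ U → ∃[ x ] ∃[ y ] (x ∈ U × y ∉ U × R x y)
∃-crossing U ε u∈U u∉U = contradiction u∈U u∉U
∃-crossing U (_◅_ {i = u} {j = w} r rs) u∈U v∉U with w ∈? U
... | yes w∈U = ∃-crossing U rs w∈U v∉U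
... | no  w∉U = u , w , u∈U , w∉U , r

-- Subtrees, spanning trees and the edge bound for connected graphs.

module _ {n m : ℕ} (G : Graph n m) where
  open Graph G

  Adjacent-sym : ∀ {S u v} → Adjacent G S u v → Adjacent G S v u
  Adjacent-sym (e , e∈S , ends≡) = e , e∈S , swap ends≡

  Adjacent-mono : ∀ {S T} → S ⊆ T → ∀ {u v} → Adjacent G S u v → Adjacent G T u v
  Adjacent-mono S⊆T (e , e∈S , ends≡) = e , S⊆T e∈S , ends≡

  Connected-mono : ∀ {S T} → S ⊆ T → Connected G S → Connected G T
  Connected-mono S⊆T (n≢0 , path) = n≢0 , λ u v → Star.map (Adjacent-mono S⊆T) (path u v)

  -- Acyclicity is encoded by counting: a connected graph with `k` edges on `suc k` vertices is a
  -- tree. The field `ends∈` guarantees that an edge leaving the vertex set is a new one.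
  record Subtree (S : Subset m) (r : Fin n) (k : ℕ) : Set where
    field
      vertices   : Subset n
      edges      : Subset m
      edges⊆S    : edges ⊆ S
      r∈         : r ∈ vertices
      ends∈      : ∀ {e} → e ∈ edges → proj₁ (ends e) ∈ vertices × proj₂ (ends e) ∈ vertices
      reach      : ∀ {v} → v ∈ vertices → Star (Adjacent G edges) r v
      ∣vertices∣ : ∣ vertices ∣ ≡ suc k
      ∣edges∣    : ∣ edges ∣ ≡ k

  trivialSubtree : ∀ {S} r → Subtree S r 0
  trivialSubtree r = record
    { vertices   = ⁅ r ⁆
    ; edges      = ⊥
    ; edges⊆S    = λ e∈⊥ → contradiction e∈⊥ ∉⊥
    ; r∈         = x∈⁅x⁆ r
    ; ends∈      = λ e∈⊥ → contradiction e∈⊥ ∉⊥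
    ; reach      = λ v∈ → subst (Star _ r) (sym (x∈⁅y⁆⇒x≡y r v∈)) ε
    ; ∣vertices∣ = ∣⁅x⁆∣≡1 r
    ; ∣edges∣    = ∣⊥∣≡0 m
    }

  -- The tree has `suc k` vertices, fewer than `n`, so it misses some vertex `v`. A walk in `S` from
  -- `r` to `v` has to leave the tree; the edge on which it does so is added together with its outer
  -- end.
  extendSubtree : ∀ {S r k} → Connected G S → suc k < n → Subtree S r k → Subtree S r (suc k)
  extendSubtree {S} {r} {k} (_ , path) 1+k<n t
    with ¬∀⟶∃¬ n (_∈ Subtree.vertices t) (_∈? Subtree.vertices t)
    (λ all∈ → <⇒≱ 1+k<n (subst (n ≤_) (Subtree.∣vertices∣ t)
      (≤-trans (≤-reflexive (sym (∣⊤∣≡n n))) (p⊆q⇒∣p∣≤∣q∣ {p = ⊤} λ {v} _ → all∈ v))))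
  ... | v , v∉U
    with ∃-crossing (Subtree.vertices t) (path r v) (Subtree.r∈ t) v∉U
  ... | x , y , x∈U , y∉U , e , e∈S , ends≡ = record
    { vertices   = U ∪ ⁅ y ⁆
    ; edges      = T ∪ ⁅ e ⁆
    ; edges⊆S    = λ f∈ → [ edges⊆S , (λ f∈⁅e⁆ → subst (_∈ S) (sym (x∈⁅y⁆⇒x≡y e f∈⁅e⁆)) e∈S) ]′ (x∈p∪q⁻ T ⁅ e ⁆ f∈)
    ; r∈         = U⊆ r∈
    ; ends∈      = ends∈′
    ; reach      = reach′
    ; ∣vertices∣ = trans (x∉p⇒∣p∪⁅x⁆∣≡1+∣p∣ y∉U) (cong suc ∣vertices∣)
    ; ∣edges∣    = trans (x∉p⇒∣p∪⁅x⁆∣≡1+∣p∣ e∉T) (cong suc ∣edges∣)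
    }
    where
    open Subtree t renaming (vertices to U; edges to T)
    U⊆ : U ⊆ U ∪ ⁅ y ⁆
    U⊆ = p⊆p∪q ⁅ y ⁆
    y∈ : y ∈ U ∪ ⁅ y ⁆
    y∈ = q⊆p∪q U ⁅ y ⁆ (x∈⁅x⁆ y)
    T⊆ : T ⊆ T ∪ ⁅ e ⁆
    T⊆ = p⊆p∪q ⁅ e ⁆
    -- Edges of the tree have both ends in `U`, but the end `y` of `e` lies outside.
    e∉T : e ∉ T
    e∉T e∈T = y∉U ([ (λ eq → subst (_∈ U) (cong proj₂ eq) (proj₂ (ends∈ e∈T)))
                    , (λ eq → subst (_∈ U) (cong proj₁ eq) (proj₁ (ends∈ e∈T))) ]′ ends≡)
    BothIn : Fin n × Fin n → Set
    BothIn (u , v) = u ∈ U ∪ ⁅ y ⁆ × v ∈ U ∪ ⁅ y ⁆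
    ends-e∈ : BothIn (ends e)
    ends-e∈ = [ (λ eq → subst BothIn (sym eq) (U⊆ x∈U , y∈))
              , (λ eq → subst BothIn (sym eq) (y∈ , U⊆ x∈U)) ]′ ends≡
    ends∈′ : ∀ {f} → f ∈ T ∪ ⁅ e ⁆ → BothIn (ends f)
    ends∈′ f∈ with x∈p∪q⁻ T ⁅ e ⁆ f∈
    ... | inj₁ f∈T = U⊆ (proj₁ (ends∈ f∈T)) , U⊆ (proj₂ (ends∈ f∈T))
    ... | inj₂ f∈⁅e⁆ with refl ← x∈⁅y⁆⇒x≡y e f∈⁅e⁆ = ends-e∈
    reach-U : ∀ {w} → w ∈ U → Star (Adjacent G (T ∪ ⁅ e ⁆)) r w
    reach-U w∈U = Star.map (Adjacent-mono T⊆) (reach w∈U)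
    reach′ : ∀ {w} → w ∈ U ∪ ⁅ y ⁆ → Star (Adjacent G (T ∪ ⁅ e ⁆)) r w
    reach′ w∈ with x∈p∪q⁻ U ⁅ y ⁆ w∈
    ... | inj₁ w∈U = reach-U w∈U
    ... | inj₂ w∈⁅y⁆ with refl ← x∈⁅y⁆⇒x≡y y w∈⁅y⁆ =
      reach-U x∈U ◅◅ (e , q⊆p∪q T ⁅ e ⁆ (x∈⁅x⁆ e) , ends≡) ◅ ε

  subtreeOfSize : ∀ {S} r → Connected G S → ∀ k → k < n → Subtree S r k
  subtreeOfSize r conn zero    _     = trivialSubtree r
  subtreeOfSize r conn (suc k) 1+k<n =
    extendSubtree conn 1+k<n (subtreeOfSize r conn k (<⇒≤ 1+k<n))

spanningTree : ∀ {n m} (G : Graph n m) {S} → Connected G S →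
  ∃[ T ] (T ⊆ S × Connected G T × ∣ T ∣ ≡ n ∸ 1)
spanningTree {zero}  G (() , _)
spanningTree {suc n} G conn = edges , edges⊆S , (_ , path) , ∣edges∣
  where
  open Subtree (subtreeOfSize G zero conn n ≤-refl)
  from-root : ∀ v → Star (Adjacent G edges) zero v
  -- Here the graph has `suc n` vertices and the subtree has `n` edges, so its `suc n` vertices are
  -- all of them.
  from-root v = reach (subst (v ∈_) (sym (∣p∣≡n⇒p≡⊤ ∣vertices∣)) ∈⊤)
  path : ∀ u v → Star (Adjacent G edges) u v
  path u v = reverse (Adjacent-sym G) (from-root u) ◅◅ from-root v

Connected⇒n≤1+∣S∣ : ∀ {n m} (G : Graph n m) {S} → Connected G S → n ≤ suc ∣ S ∣
Connected⇒n≤1+∣S∣ {n} G {S} conn with spanningTree G conn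
... | T , T⊆S , _ , ∣T∣≡n∸1 = begin
  n             ≤⟨ m≤n+m∸n n 1 ⟩
  suc (n ∸ 1)   ≡⟨ cong suc (sym ∣T∣≡n∸1) ⟩
  suc ∣ T ∣     ≤⟨ s≤s (p⊆q⇒∣p∣≤∣q∣ T⊆S) ⟩
  suc ∣ S ∣     ∎
  where open ≤-Reasoning

-- Adds `- n - p` to both sides. The counting is done with sums of naturals, whereas the hypothesis
-- of the theorem has integer differences, which may be negative.
m+n≤o+p⇒m-p≤o-n : ∀ m n o p → m + n ≤ o + p → ℤ.+ m ℤ.- ℤ.+ p ℤ.≤ ℤ.+ o ℤ.- ℤ.+ n
m+n≤o+p⇒m-p≤o-n m n o p m+n≤o+p = begin
  ℤ.+ m ℤ.- ℤ.+ p                         ≡⟨ lhs (ℤ.+ m) (ℤ.+ n) (ℤ.+ p) ⟩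
  ℤ.+ (m + n) ℤ.+ (ℤ.- ℤ.+ n ℤ.- ℤ.+ p)   ≤⟨ ℤ.+-monoˡ-≤ (ℤ.- ℤ.+ n ℤ.- ℤ.+ p) (ℤ.+≤+ m+n≤o+p) ⟩
  ℤ.+ (o + p) ℤ.+ (ℤ.- ℤ.+ n ℤ.- ℤ.+ p)   ≡⟨ rhs (ℤ.+ o) (ℤ.+ n) (ℤ.+ p) ⟩
  ℤ.+ o ℤ.- ℤ.+ n                         ∎
  where
  open ℤ.≤-Reasoning
  lhs : ∀ i j k → i ℤ.- k ≡ (i ℤ.+ j) ℤ.+ (ℤ.- j ℤ.- k)
  lhs = ℤ-Solver.solve-∀
  rhs : ∀ i j k → (i ℤ.+ k) ℤ.+ (ℤ.- j ℤ.- k) ≡ i ℤ.- j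
  rhs = ℤ-Solver.solve-∀

-- Bounds for color-connecting sets with fewer than `n - 1` edges.

module _ {n m ℓ : ℕ} (G : EdgeColoredGraph n m ℓ) where
  open EdgeColoredGraph G

  γ≡⇒∈colorClass : ∀ {e i} → γ e ≡ i → e ∈ colorClass G i
  γ≡⇒∈colorClass {i = i} = ∈-tabulate⁺ (λ e → γ e Fin.≟ i)

  ∈colorsUsedExactly⇒∣colorClass∣≡ : ∀ {t i} → i ∈ colorsUsedExactly G t → ∣ colorClass G i ∣ ≡ t
  ∈colorsUsedExactly⇒∣colorClass∣≡ {t} = ∈-tabulate⁻ (λ i → ∣ colorClass G i ∣ ≟ t)

  ColorConnecting⇒n≤1+∣W∣+t : ∀ {W t i} → ColorConnecting G W →
    i ∈ colorsUsedExactly G t → n ≤ suc (∣ W ∣ + t)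
  ColorConnecting⇒n≤1+∣W∣+t {W} {t} {i} cc i∈ = begin
    n                                ≤⟨ Connected⇒n≤1+∣S∣ graph (cc i) ⟩
    suc ∣ W ∪ colorClass G i ∣       ≤⟨ s≤s (∣p∪q∣≤∣p∣+∣q∣ W _) ⟩
    suc (∣ W ∣ + ∣ colorClass G i ∣) ≡⟨ cong (λ c → suc (∣ W ∣ + c)) (∈colorsUsedExactly⇒∣colorClass∣≡ i∈) ⟩
    suc (∣ W ∣ + t)                  ∎
    where open ≤-Reasoning

  -- If `e` were in `W`, its color class, consisting of `e` alone, would add nothing to `W`; then
  -- `W` by itself would connect all `n` vertices with fewer than `n - 1` edges.
  small-ColorConnecting-avoids : ∀ {W e} → ColorConnecting G W → suc ∣ W ∣ < n →
    γ e ∈ colorsUsedExactly G 1 → e ∉ W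
  small-ColorConnecting-avoids {W} {e} cc 1+∣W∣<n γe∈ e∈W = <⇒≱ 1+∣W∣<n (begin
    n                       ≤⟨ Connected⇒n≤1+∣S∣ graph (Connected-mono graph W∪C⊆W∪C∖e (cc (γ e))) ⟩
    suc ∣ W ∪ (C ∖ e) ∣     ≤⟨ s≤s (∣p∪q∣≤∣p∣+∣q∣ W (C ∖ e)) ⟩
    suc (∣ W ∣ + ∣ C ∖ e ∣) ≡⟨ cong (λ c → suc (∣ W ∣ + c)) ∣C∖e∣≡0 ⟩
    suc (∣ W ∣ + 0)         ≡⟨ cong suc (+-identityʳ ∣ W ∣) ⟩
    suc ∣ W ∣               ∎)
    where
    open ≤-Reasoning
    C : Subset m
    C = colorClass G (γ e)
    ∣C∖e∣≡0 : ∣ C ∖ e ∣ ≡ 0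
    -- `C` has one element and contains `e`, so removing `e` leaves fewer than one.
    ∣C∖e∣≡0 = n<1⇒n≡0 (subst (∣ C ∖ e ∣ <_) (∈colorsUsedExactly⇒∣colorClass∣≡ γe∈)
      (x∈p⇒∣p-x∣<∣p∣ (γ≡⇒∈colorClass refl)))
    W∪C⊆W∪C∖e : W ∪ C ⊆ W ∪ (C ∖ e)
    W∪C⊆W∪C∖e {f} f∈ with f Fin.≟ e | x∈p∪q⁻ W C f∈
    ... | yes refl | _        = p⊆p∪q (C ∖ e) e∈W
    ... | no  _    | inj₁ f∈W = p⊆p∪q (C ∖ e) f∈W
    ... | no  f≢e  | inj₂ f∈C = q⊆p∪q W (C ∖ e) (x∈p∧x≢y⇒x∈p-y f∈C f≢e)

  -- Each color used once is witnessed by an edge in the complement of `W`, and one edge cannot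
  -- witness two colors, so there are at most `m - ∣W∣` such colors.
  small-ColorConnecting⇒∣W∣+s≤m : ∀ {W} → ColorConnecting G W → suc ∣ W ∣ < n →
    ∣ W ∣ + ∣ colorsUsedExactly G 1 ∣ ≤ m
  small-ColorConnecting⇒∣W∣+s≤m {W} cc 1+∣W∣<n = begin
    ∣ W ∣ + ∣ colorsUsedExactly G 1 ∣ ≤⟨ +-monoʳ-≤ ∣ W ∣ (∣p∣≤∣q∣-by-covering (λ e i → γ e ≡ i)
                                         (λ p q → trans (sym p) q) _ (∁ W) cover) ⟩
    ∣ W ∣ + ∣ ∁ W ∣                   ≡⟨ cong (∣ W ∣ +_) (∣∁p∣≡n∸∣p∣ W) ⟩
    ∣ W ∣ + (m ∸ ∣ W ∣)               ≡⟨ m+[n∸m]≡n (∣p∣≤n W) ⟩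
    m                                 ∎
    where
    open ≤-Reasoning
    cover : ∀ {i} → i ∈ colorsUsedExactly G 1 → ∃[ e ] (e ∈ ∁ W × γ e ≡ i)
    cover {i} i∈ with γ-surjective i
    -- Surjectivity of `γ` supplies the edge, and the preceding lemma keeps it out of `W`.
    ... | e , γe≡ with refl ← γe≡ refl =
      e , x∉p⇒x∈∁p (small-ColorConnecting-avoids cc 1+∣W∣<n i∈) , refl

  -- This is `n - 2 ≤ m - s` written without subtraction, the negation of the hypothesis of the
  -- theorem.
  small-ColorConnecting⇒n+s≤m+2 : ∀ {W} → ColorConnecting G W → suc ∣ W ∣ < n →
    n + ∣ colorsUsedExactly G 1 ∣ ≤ m + 2
  small-ColorConnecting⇒n+s≤m+2 {W} cc 1+∣W∣<n with nonempty? (colorsUsedExactly G 1)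
  -- A color used once adds a single edge to `W`, hence `n ≤ ∣W∣ + 2`; this is combined with
  -- `∣W∣ + s ≤ m`.
  ... | yes (i , i∈) = begin
    n + s               ≤⟨ +-monoˡ-≤ s (ColorConnecting⇒n≤1+∣W∣+t cc i∈) ⟩
    suc (∣ W ∣ + 1) + s ≡⟨ cong (_+ s) (sym (+-suc ∣ W ∣ 1)) ⟩
    ∣ W ∣ + 2 + s       ≡⟨ +-assoc ∣ W ∣ 2 s ⟩
    ∣ W ∣ + (2 + s)     ≡⟨ cong (∣ W ∣ +_) (+-comm 2 s) ⟩
    ∣ W ∣ + (s + 2)     ≡⟨ sym (+-assoc ∣ W ∣ s 2) ⟩
    ∣ W ∣ + s + 2       ≤⟨ +-monoˡ-≤ 2 (small-ColorConnecting⇒∣W∣+s≤m cc 1+∣W∣<n) ⟩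
    m + 2               ∎
    where
    open ≤-Reasoning
    s = ∣ colorsUsedExactly G 1 ∣
  -- Now `s = 0`, and connectedness of the whole graph already gives `n ≤ m + 1`, with one to spare.
  ... | no empty = begin
    n + ∣ colorsUsedExactly G 1 ∣ ≡⟨ cong (λ p → n + ∣ p ∣) (Empty-unique empty) ⟩
    n + ∣ ⊥ {ℓ} ∣                 ≡⟨ cong (n +_) (∣⊥∣≡0 ℓ) ⟩
    n + 0                         ≡⟨ +-identityʳ n ⟩
    n                             ≤⟨ Connected⇒n≤1+∣S∣ graph connected ⟩
    suc ∣ ⊤ {m} ∣                 ≡⟨ cong suc (∣⊤∣≡n m) ⟩
    1 + m                         ≡⟨ +-comm 1 m ⟩
    m + 1                         ≤⟨ +-monoʳ-≤ m (n≤1+n 1) ⟩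
    m + 2                         ∎
    where open ≤-Reasoning

-- The value of the wild number.

open import Data.Integer using (+_; _-_; _>_)

corollary6p6 : ∀ {n m ℓ s : ℕ} (G : EdgeColoredGraph n m ℓ) →
    ℓ ≥ 2 →
    ∣ colorsUsedExactly G 1 ∣ ≡ s →
    + n - + 2 > + m - + s →
    WildNumberIs G (n ∸ 1)
corollary6p6 {n} {m} {s = s} G _ refl n-2>m-s = attained , minimal
  where
  open EdgeColoredGraph G
  attained : ∃[ W ] (ColorConnecting G W × ∣ W ∣ ≡ n ∸ 1)
  attained with spanningTree graph connected
  -- A spanning tree stays connected when any color class is added to it.
  ... | T , _ , conn , ∣T∣≡ = T , (λ i → Connected-mono graph (p⊆p∪q (colorClass G i)) conn) , ∣T∣≡
  minimal : ∀ W → ColorConnecting G W → n ∸ 1 ≤ ∣ W ∣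
  minimal W cc with n ≤? suc ∣ W ∣
  ... | yes n≤1+∣W∣ = m≤n+o⇒m∸n≤o n 1 n≤1+∣W∣
  -- Here `W` has fewer than `n - 1` edges, so the bounds above force `n - 2 ≤ m - s`.
  ... | no  n≰1+∣W∣ = contradiction
    (m+n≤o+p⇒m-p≤o-n n s m 2 (small-ColorConnecting⇒n+s≤m+2 G cc (≰⇒> n≰1+∣W∣)))
    (ℤ.<⇒≱ n-2>m-s)
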